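{- Let $m\geqslant 7$ be an odd integer. Whatever the choice of $\alpha\in\overline{\mathbb F}_2^{\ast}$, the polynomial $L_\alpha(x^m)$ has distinct critical values if and only if the following condition is satisfied: for $\zeta_1$ and $\zeta_2$ in $\overline{\mathbb F}_2\setminus\{1\}$, the equalities $$\zeta_1^{m-1}=\zeta_2^{m-1}=\left(\frac{1+\zeta_1}{1+\zeta_2}\right)^{m-1}=1$$ imply $\zeta_1=\zeta_2$ or $\zeta_1=\zeta_2^{ -1}$.
   Context: For $f\in\overline{\mathbb F}_2[x]$ and $\alpha\in\overline{\mathbb F}_2^{\ast}$, put $D_\alpha f(x)=f(x+\alpha)+f(x)$, and let $L_\alpha f$ denote the unique polynomial $g\in\overline{\mathbb F}_2[x]$ such that $g(x(x+\alpha))=D_\alpha f(x)$. A polynomial $g\in\overline{\mathbb F}_2[x]$ is said to have distinct critical values if for all $\tau,\eta\in\overline{\mathbb F}_2$, $g'(\tau)=g'(\eta)=0$ and $g(\tau)=g(\eta)$ imply $\tau=\eta$. -}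

module Defs where

open import Algebra.Bundles using (CommutativeSemiring; CommutativeRing)
open import Data.List.Base using (List; []; _∷_; map)
open import Data.Nat.Base using (ℕ; zero; suc)
open import Data.Product using (∃; ∃!; _×_; _,_; proj₁)
open import Data.Sum.Base using (_⊎_)
open import Level using (_⊔_) renaming (suc to lsuc)
open import Relation.Binary.Definitions using (Decidable)
open import Relation.Binary.Structures using (IsEquivalence)
open import Relation.Binary.Bundles using (Setoid)
open import Relation.Nullary.Negation.Core using (¬_)
import Algebra.Definitions.RawMonoid as RawMonoidDefs
import Algebra.Definitions.RawSemiring as RawSemiringDefs
import Algebra.Properties.Group as GroupProperties
import Algebra.Solver.Ring.NaturalCoefficients.Default as NatSolver
import Algebra.Structures as Structures
import Algebra.Structures.Biased as Biased
import Relation.Binary.Reasoning.Setoid as SetoidReasoning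

-- Univariate polynomials as coefficient lists, lowest degree first.  Trailing
-- zeros are allowed, so equality of polynomials is _≋_, not _≡_.

module Polynomial {c ℓ} (R : CommutativeSemiring c ℓ) where

  open CommutativeSemiring R
  open RawMonoidDefs +-rawMonoid using () renaming (_×_ to _·_)

  infix  4 _≋_
  infixl 6 _⊕_
  infixl 7 _⊗_

  Poly : Set c
  Poly = List Carrier

  coeff : Poly → ℕ → Carrier
  coeff []      _       = 0#
  coeff (a ∷ _) zero    = a
  coeff (_ ∷ p) (suc n) = coeff p n

  record _≋_ (p q : Poly) : Set ℓ where
    constructor mk≋
    field at : ∀ n → coeff p n ≈ coeff q n
  open _≋_ public

  C : Carrier → Poly
  C a = a ∷ []

  X : Poly
  X = 0# ∷ 1# ∷ []

  _⊕_ : Poly → Poly → Poly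
  []      ⊕ q       = q
  (a ∷ p) ⊕ []      = a ∷ p
  (a ∷ p) ⊕ (b ∷ q) = a + b ∷ p ⊕ q

  scale : Carrier → Poly → Poly
  scale a = map (a *_)

  _⊗_ : Poly → Poly → Poly
  []      ⊗ q = []
  (a ∷ p) ⊗ q = scale a q ⊕ (0# ∷ p ⊗ q)

  eval : Poly → Carrier → Carrier
  eval []      x = 0#
  eval (a ∷ p) x = a + x * eval p x

  -- comp p q is p(q(x)).
  comp : Poly → Poly → Poly
  comp []      q = []
  comp (a ∷ p) q = C a ⊕ q ⊗ comp p q

  -- derivFrom k (a₀ ∷ a₁ ∷ …) = k·a₀ ∷ (k+1)·a₁ ∷ …
  derivFrom : ℕ → Poly → Poly
  derivFrom k []      = []
  derivFrom k (a ∷ p) = k · a ∷ derivFrom (suc k) p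

  deriv : Poly → Poly
  deriv []      = []
  deriv (_ ∷ p) = derivFrom 1 p

  ≋-refl : ∀ {p} → p ≋ p
  ≋-refl = mk≋ λ _ → refl

  ≋-sym : ∀ {p q} → p ≋ q → q ≋ p
  ≋-sym e = mk≋ λ n → sym (at e n)

  ≋-trans : ∀ {p q r} → p ≋ q → q ≋ r → p ≋ r
  ≋-trans e f = mk≋ λ n → trans (at e n) (at f n)

  ≋-isEquivalence : IsEquivalence _≋_
  ≋-isEquivalence = record { refl = ≋-refl ; sym = ≋-sym ; trans = ≋-trans }

  ∷-cong : ∀ {a b p q} → a ≈ b → p ≋ q → a ∷ p ≋ b ∷ q
  ∷-cong a≈b e = mk≋ λ { zero → a≈b ; (suc n) → at e n }

  0∷[]≋[] : C 0# ≋ []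
  0∷[]≋[] = mk≋ λ { zero → refl ; (suc _) → refl }

  coeff-⊕ : ∀ p q n → coeff (p ⊕ q) n ≈ coeff p n + coeff q n
  coeff-⊕ []      q       n       = sym (+-identityˡ _)
  coeff-⊕ (a ∷ p) []      n       = sym (+-identityʳ _)
  coeff-⊕ (a ∷ p) (b ∷ q) zero    = refl
  coeff-⊕ (a ∷ p) (b ∷ q) (suc n) = coeff-⊕ p q n

  coeff-scale : ∀ a p n → coeff (scale a p) n ≈ a * coeff p n
  coeff-scale a []      n       = sym (zeroʳ a)
  coeff-scale a (b ∷ p) zero    = refl
  coeff-scale a (b ∷ p) (suc n) = coeff-scale a p n

  ⊕-cong : ∀ {p p′ q q′} → p ≋ p′ → q ≋ q′ → p ⊕ q ≋ p′ ⊕ q′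
  ⊕-cong {p} {p′} {q} {q′} e f = mk≋ λ n →
    trans (coeff-⊕ p q n) (trans (+-cong (at e n) (at f n)) (sym (coeff-⊕ p′ q′ n)))

  ⊕-assoc : ∀ p q r → (p ⊕ q) ⊕ r ≋ p ⊕ (q ⊕ r)
  ⊕-assoc p q r = mk≋ λ n →
    trans (coeff-⊕ (p ⊕ q) r n)
    (trans (+-congʳ (coeff-⊕ p q n))
    (trans (+-assoc _ _ _)
    (trans (+-congˡ (sym (coeff-⊕ q r n))) (sym (coeff-⊕ p (q ⊕ r) n)))))

  ⊕-comm : ∀ p q → p ⊕ q ≋ q ⊕ p
  ⊕-comm p q = mk≋ λ n →
    trans (coeff-⊕ p q n) (trans (+-comm _ _) (sym (coeff-⊕ q p n)))

  ⊕-identityˡ : ∀ p → [] ⊕ p ≋ p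
  ⊕-identityˡ p = ≋-refl

  ⊕-identityʳ : ∀ p → p ⊕ [] ≋ p
  ⊕-identityʳ p = ⊕-comm p []

  open Structures _≋_ using (IsCommutativeMonoid)

  ⊕-isCommutativeMonoid : IsCommutativeMonoid _⊕_ []
  ⊕-isCommutativeMonoid = record
    { isMonoid = record
      { isSemigroup = record
        { isMagma = record { isEquivalence = ≋-isEquivalence ; ∙-cong = ⊕-cong }
        ; assoc   = ⊕-assoc
        }
      ; identity = ⊕-identityˡ , ⊕-identityʳ
      }
    ; comm = ⊕-comm
    }

  private
    ≋-setoid : Setoid c ℓ
    ≋-setoid = record { isEquivalence = ≋-isEquivalence }
    open SetoidReasoning ≋-setoid

    ⊕-interchange : ∀ p q r s → (p ⊕ q) ⊕ (r ⊕ s) ≋ (p ⊕ r) ⊕ (q ⊕ s)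
    ⊕-interchange p q r s = begin
      (p ⊕ q) ⊕ (r ⊕ s)  ≈⟨ ⊕-assoc p q (r ⊕ s) ⟩
      p ⊕ (q ⊕ (r ⊕ s))  ≈⟨ ⊕-cong (≋-refl {p}) (≋-sym (⊕-assoc q r s)) ⟩
      p ⊕ ((q ⊕ r) ⊕ s)  ≈⟨ ⊕-cong (≋-refl {p}) (⊕-cong (⊕-comm q r) ≋-refl) ⟩
      p ⊕ ((r ⊕ q) ⊕ s)  ≈⟨ ⊕-cong (≋-refl {p}) (⊕-assoc r q s) ⟩
      p ⊕ (r ⊕ (q ⊕ s))  ≈⟨ ≋-sym (⊕-assoc p r (q ⊕ s)) ⟩
      (p ⊕ r) ⊕ (q ⊕ s)  ∎

  scale-cong : ∀ {a b p q} → a ≈ b → p ≋ q → scale a p ≋ scale b q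
  scale-cong {a} {b} {p} {q} e f = mk≋ λ n →
    trans (coeff-scale a p n) (trans (*-cong e (at f n)) (sym (coeff-scale b q n)))

  scale-zero : ∀ p → scale 0# p ≋ []
  scale-zero p = mk≋ λ n → trans (coeff-scale 0# p n) (zeroˡ _)

  scale-one : ∀ p → scale 1# p ≋ p
  scale-one p = mk≋ λ n → trans (coeff-scale 1# p n) (*-identityˡ _)

  scale-scale : ∀ a b p → scale a (scale b p) ≋ scale (a * b) p
  scale-scale a b p = mk≋ λ n →
    trans (coeff-scale a (scale b p) n)
    (trans (*-congˡ (coeff-scale b p n))
    (trans (sym (*-assoc a b _)) (sym (coeff-scale (a * b) p n))))

  scale-⊕ : ∀ a p q → scale a (p ⊕ q) ≋ scale a p ⊕ scale a q
  scale-⊕ a p q = mk≋ λ n →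
    trans (coeff-scale a (p ⊕ q) n)
    (trans (*-congˡ (coeff-⊕ p q n))
    (trans (distribˡ a _ _)
    (trans (sym (+-cong (coeff-scale a p n) (coeff-scale a q n)))
           (sym (coeff-⊕ (scale a p) (scale a q) n)))))

  scale-+ : ∀ a b p → scale (a + b) p ≋ scale a p ⊕ scale b p
  scale-+ a b p = mk≋ λ n →
    trans (coeff-scale (a + b) p n)
    (trans (distribʳ _ a b)
    (trans (sym (+-cong (coeff-scale a p n) (coeff-scale b p n)))
           (sym (coeff-⊕ (scale a p) (scale b p) n))))

  ⊗-zeroˡ : ∀ p → [] ⊗ p ≋ []
  ⊗-zeroˡ _ = ≋-refl

  ⊗-zeroʳ : ∀ p → p ⊗ [] ≋ []
  ⊗-zeroʳ []      = ≋-refl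
  ⊗-zeroʳ (a ∷ p) = ≋-trans (∷-cong refl (⊗-zeroʳ p)) 0∷[]≋[]

  ⊗-∷ʳ : ∀ p b q → p ⊗ (b ∷ q) ≋ scale b p ⊕ (0# ∷ p ⊗ q)
  ⊗-∷ʳ []      b q = ≋-sym 0∷[]≋[]
  ⊗-∷ʳ (a ∷ p) b q = ∷-cong (+-congʳ (*-comm a b)) (begin
    scale a q ⊕ p ⊗ (b ∷ q)                 ≈⟨ ⊕-cong ≋-refl (⊗-∷ʳ p b q) ⟩
    scale a q ⊕ (scale b p ⊕ (0# ∷ p ⊗ q))  ≈⟨ ≋-sym (⊕-assoc (scale a q) (scale b p) _) ⟩
    scale a q ⊕ scale b p ⊕ (0# ∷ p ⊗ q)    ≈⟨ ⊕-cong (⊕-comm (scale a q) (scale b p)) ≋-refl ⟩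
    scale b p ⊕ scale a q ⊕ (0# ∷ p ⊗ q)    ≈⟨ ⊕-assoc (scale b p) (scale a q) _ ⟩
    scale b p ⊕ (scale a q ⊕ (0# ∷ p ⊗ q))  ∎)

  ⊗-comm : ∀ p q → p ⊗ q ≋ q ⊗ p
  ⊗-comm []      q = ≋-sym (⊗-zeroʳ q)
  ⊗-comm (a ∷ p) q = begin
    scale a q ⊕ (0# ∷ p ⊗ q)  ≈⟨ ⊕-cong ≋-refl (∷-cong refl (⊗-comm p q)) ⟩
    scale a q ⊕ (0# ∷ q ⊗ p)  ≈⟨ ≋-sym (⊗-∷ʳ q a p) ⟩
    q ⊗ (a ∷ p)               ∎

  ⊗-congˡ : ∀ p {q q′} → q ≋ q′ → p ⊗ q ≋ p ⊗ q′
  ⊗-congˡ []      e = ≋-refl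
  ⊗-congˡ (a ∷ p) e = ⊕-cong (scale-cong refl e) (∷-cong refl (⊗-congˡ p e))

  ⊗-cong : ∀ {p p′ q q′} → p ≋ p′ → q ≋ q′ → p ⊗ q ≋ p′ ⊗ q′
  ⊗-cong {p} {p′} {q} {q′} e f = begin
    p ⊗ q    ≈⟨ ⊗-congˡ p f ⟩
    p ⊗ q′   ≈⟨ ⊗-comm p q′ ⟩
    q′ ⊗ p   ≈⟨ ⊗-congˡ q′ e ⟩
    q′ ⊗ p′  ≈⟨ ⊗-comm q′ p′ ⟩
    p′ ⊗ q′  ∎

  ⊗-distribʳ : ∀ r p q → (p ⊕ q) ⊗ r ≋ p ⊗ r ⊕ q ⊗ r
  ⊗-distribʳ r []      q       = ≋-refl
  ⊗-distribʳ r (a ∷ p) []      = ≋-sym (⊕-identityʳ _)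
  ⊗-distribʳ r (a ∷ p) (b ∷ q) = begin
    scale (a + b) r ⊕ (0# ∷ (p ⊕ q) ⊗ r)
      ≈⟨ ⊕-cong (scale-+ a b r) (∷-cong (sym (+-identityˡ 0#)) (⊗-distribʳ r p q)) ⟩
    (scale a r ⊕ scale b r) ⊕ ((0# ∷ p ⊗ r) ⊕ (0# ∷ q ⊗ r))
      ≈⟨ ⊕-interchange (scale a r) (scale b r) _ _ ⟩
    (scale a r ⊕ (0# ∷ p ⊗ r)) ⊕ (scale b r ⊕ (0# ∷ q ⊗ r)) ∎

  scale-⊗ : ∀ a p q → scale a p ⊗ q ≋ scale a (p ⊗ q)
  scale-⊗ a []      q = ≋-refl
  scale-⊗ a (b ∷ p) q = begin
    scale (a * b) q ⊕ (0# ∷ scale a p ⊗ q)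
      ≈⟨ ⊕-cong (≋-sym (scale-scale a b q)) (∷-cong (sym (zeroʳ a)) (scale-⊗ a p q)) ⟩
    scale a (scale b q) ⊕ scale a (0# ∷ p ⊗ q)
      ≈⟨ ≋-sym (scale-⊕ a (scale b q) _) ⟩
    scale a (scale b q ⊕ (0# ∷ p ⊗ q)) ∎

  0∷-⊗ : ∀ p q → (0# ∷ p) ⊗ q ≋ 0# ∷ p ⊗ q
  0∷-⊗ p q = ⊕-cong (scale-zero q) ≋-refl

  ⊗-assoc : ∀ p q r → (p ⊗ q) ⊗ r ≋ p ⊗ (q ⊗ r)
  ⊗-assoc []      q r = ≋-refl
  ⊗-assoc (a ∷ p) q r = begin
    (scale a q ⊕ (0# ∷ p ⊗ q)) ⊗ r          ≈⟨ ⊗-distribʳ r (scale a q) _ ⟩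
    scale a q ⊗ r ⊕ (0# ∷ p ⊗ q) ⊗ r        ≈⟨ ⊕-cong (scale-⊗ a q r) (0∷-⊗ (p ⊗ q) r) ⟩
    scale a (q ⊗ r) ⊕ (0# ∷ (p ⊗ q) ⊗ r)    ≈⟨ ⊕-cong ≋-refl (∷-cong refl (⊗-assoc p q r)) ⟩
    scale a (q ⊗ r) ⊕ (0# ∷ p ⊗ (q ⊗ r))    ∎

  C-⊗ : ∀ a p → C a ⊗ p ≋ scale a p
  C-⊗ a p = ≋-trans (⊕-cong ≋-refl 0∷[]≋[]) (⊕-identityʳ _)

  X-⊗ : ∀ p → X ⊗ p ≋ 0# ∷ p
  X-⊗ p = ≋-trans (0∷-⊗ (C 1#) p) (∷-cong refl (≋-trans (C-⊗ 1# p) (scale-one p)))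

  ⊗-identityˡ : ∀ p → C 1# ⊗ p ≋ p
  ⊗-identityˡ p = ≋-trans (C-⊗ 1# p) (scale-one p)

  ⊗-isCommutativeMonoid : IsCommutativeMonoid _⊗_ (C 1#)
  ⊗-isCommutativeMonoid = record
    { isMonoid = record
      { isSemigroup = record
        { isMagma = record { isEquivalence = ≋-isEquivalence ; ∙-cong = ⊗-cong }
        ; assoc   = ⊗-assoc
        }
      ; identity = ⊗-identityˡ , λ p → ≋-trans (⊗-comm p (C 1#)) (⊗-identityˡ p)
      }
    ; comm = ⊗-comm
    }

  polySemiring : CommutativeSemiring c ℓ
  polySemiring = record
    { isCommutativeSemiring = Biased.isCommutativeSemiringˡ record
      { +-isCommutativeMonoid = ⊕-isCommutativeMonoid
      ; *-isCommutativeMonoid = ⊗-isCommutativeMonoid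
      ; distribʳ              = ⊗-distribʳ
      ; zeroˡ                 = ⊗-zeroˡ
      }
    }

  open RawSemiringDefs (CommutativeSemiring.rawSemiring polySemiring) public
    using () renaming (_^_ to _^ᴾ_)

  private
    module S = NatSolver polySemiring
    open S using (_:+_; _:*_; _:=_)

  comp-X : ∀ p → comp p X ≋ p
  comp-X []      = ≋-refl
  comp-X (a ∷ p) = begin
    C a ⊕ X ⊗ comp p X  ≈⟨ ⊕-cong (≋-refl {C a}) (≋-trans (X-⊗ _) (∷-cong refl (comp-X p))) ⟩
    C a ⊕ (0# ∷ p)      ≈⟨ ∷-cong (+-identityʳ a) ≋-refl ⟩
    a ∷ p               ∎

  comp-⊕ : ∀ p q s → comp (p ⊕ q) s ≋ comp p s ⊕ comp q s
  comp-⊕ []      q       s = ≋-refl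
  comp-⊕ (a ∷ p) []      s = ≋-sym (⊕-identityʳ _)
  comp-⊕ (a ∷ p) (b ∷ q) s = begin
    (C a ⊕ C b) ⊕ s ⊗ comp (p ⊕ q) s
      ≈⟨ ⊕-cong (≋-refl {C a ⊕ C b}) (⊗-congˡ s (comp-⊕ p q s)) ⟩
    (C a ⊕ C b) ⊕ s ⊗ (comp p s ⊕ comp q s)
      ≈⟨ S.solve 5 (λ x y z u v → (x :+ y) :+ z :* (u :+ v) := (x :+ z :* u) :+ (y :+ z :* v))
           ≋-refl (C a) (C b) s (comp p s) (comp q s) ⟩
    (C a ⊕ s ⊗ comp p s) ⊕ (C b ⊕ s ⊗ comp q s) ∎

  comp-scale : ∀ a p s → comp (scale a p) s ≋ C a ⊗ comp p s
  comp-scale a []      s = ≋-sym (⊗-zeroʳ (C a))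
  comp-scale a (b ∷ p) s = begin
    C (a * b) ⊕ s ⊗ comp (scale a p) s
      ≈⟨ ⊕-cong (≋-sym (C-⊗ a (C b))) (⊗-congˡ s (comp-scale a p s)) ⟩
    C a ⊗ C b ⊕ s ⊗ (C a ⊗ comp p s)
      ≈⟨ S.solve 4 (λ x y z u → x :* y :+ z :* (x :* u) := x :* (y :+ z :* u))
           ≋-refl (C a) (C b) s (comp p s) ⟩
    C a ⊗ (C b ⊕ s ⊗ comp p s) ∎

-- A field with decidable equality.  The inverse is total, with 0⁻¹ = 0 as
-- placeholder value.

record DiscreteField c ℓ : Set (lsuc (c ⊔ ℓ)) where
  infix 4 _≟_
  infix 8 _⁻¹
  infixl 7 _/_
  field
    commutativeRing : CommutativeRing c ℓ
  open CommutativeRing commutativeRing public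
  field
    _≟_       : Decidable _≈_
    1≉0       : ¬ 1# ≈ 0#
    _⁻¹       : Carrier → Carrier
    ⁻¹-cong   : ∀ {x y} → x ≈ y → x ⁻¹ ≈ y ⁻¹
    0⁻¹       : 0# ⁻¹ ≈ 0#
    *-inverse : ∀ {x} → ¬ x ≈ 0# → x * x ⁻¹ ≈ 1#

  _/_ : Carrier → Carrier → Carrier
  x / y = x * y ⁻¹

  open CommutativeSemiring commutativeSemiring public using (rawSemiring)
  open RawSemiringDefs rawSemiring public using (_^_)
  open Polynomial commutativeSemiring public

-- An algebraic closure of 𝔽₂.  In characteristic 2 the prime field is {0, 1},
-- so a polynomial over 𝔽₂ is one all of whose coefficients are 0 or 1.

record AlgebraicClosureOf𝔽₂ c ℓ : Set (lsuc (c ⊔ ℓ)) where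
  field
    discreteField : DiscreteField c ℓ
  open DiscreteField discreteField public
  field
    char2     : 1# + 1# ≈ 0#
    algebraic : ∀ x → ∃ λ p →
                (∀ n → coeff p n ≈ 0# ⊎ coeff p n ≈ 1#) ×
                (∃ λ n → ¬ coeff p n ≈ 0#) ×
                eval p x ≈ 0#
    closed    : ∀ p → (∃ λ n → ¬ coeff p (suc n) ≈ 0#) → ∃ λ x → eval p x ≈ 0#

module DerivativeReduction {c ℓ} (K : AlgebraicClosureOf𝔽₂ c ℓ) where

  open AlgebraicClosureOf𝔽₂ K hiding (zero)

  D : Carrier → Poly → Poly
  D α f = comp f (X ⊕ C α) ⊕ f

  IsL : Carrier → Poly → Poly → Set ℓ
  IsL α f g = comp g (X ⊗ (X ⊕ C α)) ≋ D α f

  private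
    open SetoidReasoning (CommutativeSemiring.setoid polySemiring)
    module S = NatSolver polySemiring
    open S using (_:+_; _:*_; _:=_)

    ⊕-double : ∀ p → p ⊕ p ≋ []
    ⊕-double p = mk≋ λ n → trans (coeff-⊕ p p n) (double (coeff p n))
      where
      double : ∀ a → a + a ≈ 0#
      double a = trans (sym (+-cong (*-identityˡ a) (*-identityˡ a)))
        (trans (sym (distribʳ a 1# 1#)) (trans (*-congʳ char2) (zeroˡ a)))

    -- With y = x(x+α) one has x² = αx + y, so every polynomial f in x is
    -- A(y) + x B(y), with A = part₀ α f and B = part₁ α f.  As D α kills A(y) and
    -- sends x B(y) to α B(y), the polynomial L α f is α B.
    part₀ part₁ : Carrier → Poly → Poly
    part₀ α []      = []
    part₀ α (a ∷ f) = a ∷ part₁ α f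
    part₁ α []      = []
    part₁ α (a ∷ f) = part₀ α f ⊕ scale α (part₁ α f)

    decompose : ∀ α y s → s ⊗ s ≋ C α ⊗ s ⊕ y → ∀ f →
                comp f s ≋ comp (part₀ α f) y ⊕ s ⊗ comp (part₁ α f) y
    decompose α y s s² []      = ≋-sym (⊗-zeroʳ s)
    decompose α y s s² (a ∷ f) = begin
      C a ⊕ s ⊗ comp f s
        ≈⟨ ⊕-cong (≋-refl {C a}) (⊗-congˡ s (decompose α y s s² f)) ⟩
      C a ⊕ s ⊗ (A ⊕ s ⊗ B)
        ≈⟨ S.solve 4 (λ c s A B → c :+ s :* (A :+ s :* B) := c :+ (s :* A :+ (s :* s) :* B))
             ≋-refl (C a) s A B ⟩
      C a ⊕ (s ⊗ A ⊕ (s ⊗ s) ⊗ B)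
        ≈⟨ ⊕-cong (≋-refl {C a}) (⊕-cong (≋-refl {s ⊗ A}) (⊗-cong s² (≋-refl {B}))) ⟩
      C a ⊕ (s ⊗ A ⊕ (C α ⊗ s ⊕ y) ⊗ B)
        ≈⟨ S.solve 6 (λ c s A B e y → c :+ (s :* A :+ (e :* s :+ y) :* B)
                                     := (c :+ y :* B) :+ s :* (A :+ e :* B))
             ≋-refl (C a) s A B (C α) y ⟩
      (C a ⊕ y ⊗ B) ⊕ s ⊗ (A ⊕ C α ⊗ B)
        ≈⟨ ⊕-cong (≋-refl {C a ⊕ y ⊗ B}) (⊗-congˡ s (≋-sym
             (≋-trans (comp-⊕ (part₀ α f) (scale α (part₁ α f)) y)
                      (⊕-cong (≋-refl {A}) (comp-scale α (part₁ α f) y))))) ⟩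
      (C a ⊕ y ⊗ B) ⊕ s ⊗ comp (part₀ α f ⊕ scale α (part₁ α f)) y ∎
      where
      A = comp (part₀ α f) y
      B = comp (part₁ α f) y

  IsL-exists : ∀ α f → IsL α f (scale α (part₁ α f))
  IsL-exists α f = begin
    comp (scale α (part₁ α f)) y
      ≈⟨ comp-scale α (part₁ α f) y ⟩
    C α ⊗ B
      ≈⟨ ≋-sym (⊕-identityʳ _) ⟩
    C α ⊗ B ⊕ []
      ≈⟨ ⊕-cong (≋-refl {C α ⊗ B}) (≋-sym (⊕-double (A ⊕ X ⊗ B))) ⟩
    C α ⊗ B ⊕ ((A ⊕ X ⊗ B) ⊕ (A ⊕ X ⊗ B))
      ≈⟨ S.solve 4 (λ e A B x → e :* B :+ ((A :+ x :* B) :+ (A :+ x :* B))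
                               := (A :+ (x :+ e) :* B) :+ (A :+ x :* B))
           ≋-refl (C α) A B X ⟩
    (A ⊕ (X ⊕ C α) ⊗ B) ⊕ (A ⊕ X ⊗ B)
      ≈⟨ ⊕-cong (≋-sym (decompose α y (X ⊕ C α) [x+α]² f)) (≋-sym (decompose α y X x² f)) ⟩
    comp f (X ⊕ C α) ⊕ comp f X
      ≈⟨ ⊕-cong (≋-refl {comp f (X ⊕ C α)}) (comp-X f) ⟩
    D α f ∎
    where
    y = X ⊗ (X ⊕ C α)
    A = comp (part₀ α f) y
    B = comp (part₁ α f) y

    [x+α]² : (X ⊕ C α) ⊗ (X ⊕ C α) ≋ C α ⊗ (X ⊕ C α) ⊕ y
    [x+α]² = S.solve 2 (λ x e → (x :+ e) :* (x :+ e) := e :* (x :+ e) :+ x :* (x :+ e))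
               ≋-refl X (C α)

    x² : X ⊗ X ≋ C α ⊗ X ⊕ y
    x² = begin
      X ⊗ X                          ≈⟨ ≋-sym (⊕-identityʳ _) ⟩
      X ⊗ X ⊕ []                     ≈⟨ ⊕-cong (≋-refl {X ⊗ X}) (≋-sym (⊕-double (C α ⊗ X))) ⟩
      X ⊗ X ⊕ (C α ⊗ X ⊕ C α ⊗ X)    ≈⟨ S.solve 2 (λ x e → x :* x :+ (e :* x :+ e :* x)
                                                         := e :* x :+ x :* (x :+ e))
                                          ≋-refl X (C α) ⟩
      C α ⊗ X ⊕ X ⊗ (X ⊕ C α)        ∎

  private
    open GroupProperties +-group using () renaming (∙-cancelˡ to +-cancelˡ; ∙-cancelʳ to +-cancelʳ)

    *-cancelˡ : ∀ {α} → ¬ α ≈ 0# → ∀ {x y} → α * x ≈ α * y → x ≈ y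
    *-cancelˡ {α} α≉0 {x} {y} e = trans (sym (undo x)) (trans (*-congˡ e) (undo y))
      where
      undo : ∀ z → α ⁻¹ * (α * z) ≈ z
      undo z = trans (sym (*-assoc _ α z))
        (trans (*-congʳ (trans (*-comm _ α) (*-inverse α≉0))) (*-identityˡ z))

    y⊗ : ∀ α u → (X ⊗ (X ⊕ C α)) ⊗ u ≋ 0# ∷ (0# ∷ u) ⊕ scale α u
    y⊗ α u = begin
      (X ⊗ (X ⊕ C α)) ⊗ u      ≈⟨ ⊗-assoc X (X ⊕ C α) u ⟩
      X ⊗ ((X ⊕ C α) ⊗ u)      ≈⟨ X-⊗ _ ⟩
      0# ∷ (X ⊕ C α) ⊗ u       ≈⟨ ∷-cong refl (⊗-distribʳ u X (C α)) ⟩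
      0# ∷ X ⊗ u ⊕ C α ⊗ u     ≈⟨ ∷-cong refl (⊕-cong (X-⊗ u) (C-⊗ α u)) ⟩
      0# ∷ (0# ∷ u) ⊕ scale α u ∎

    ⊕scale-injective : ∀ {α} → ¬ α ≈ 0# → ∀ u v →
                       (0# ∷ u) ⊕ scale α u ≋ (0# ∷ v) ⊕ scale α v → u ≋ v
    ⊕scale-injective {α} α≉0 u v e = mk≋ go
      where
      expand : ∀ w n → coeff ((0# ∷ w) ⊕ scale α w) n ≈ coeff (0# ∷ w) n + α * coeff w n
      expand w n = trans (coeff-⊕ (0# ∷ w) (scale α w) n) (+-congˡ (coeff-scale α w n))

      e′ : ∀ n → coeff (0# ∷ u) n + α * coeff u n ≈ coeff (0# ∷ v) n + α * coeff v n
      e′ n = trans (sym (expand u n)) (trans (at e n) (expand v n))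

      go : ∀ n → coeff u n ≈ coeff v n
      go zero    = *-cancelˡ α≉0 (+-cancelˡ 0# _ _ (e′ zero))
      go (suc n) = *-cancelˡ α≉0 (+-cancelˡ (coeff u n) _ _
        (trans (e′ (suc n)) (+-congʳ (sym (go n)))))

  comp-injective : ∀ {α} → ¬ α ≈ 0# → ∀ g h →
                   comp g (X ⊗ (X ⊕ C α)) ≋ comp h (X ⊗ (X ⊕ C α)) → g ≋ h
  comp-injective {α} α≉0 = go
    where
    y = X ⊗ (X ⊕ C α)

    step : ∀ {a b} u v → C a ⊕ y ⊗ u ≋ C b ⊕ y ⊗ v → (a ≈ b) × (u ≋ v)
    step {a} {b} u v e = +-cancelʳ 0# _ _ (at e′ zero)
                       , ⊕scale-injective α≉0 u v (mk≋ λ n → at e′ (suc n))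
      where
      e′ : C a ⊕ (0# ∷ (0# ∷ u) ⊕ scale α u) ≋ C b ⊕ (0# ∷ (0# ∷ v) ⊕ scale α v)
      e′ = ≋-trans (⊕-cong (≋-refl {C a}) (≋-sym (y⊗ α u)))
             (≋-trans e (⊕-cong (≋-refl {C b}) (y⊗ α v)))

    []≋ : [] ≋ C 0# ⊕ y ⊗ []
    []≋ = ≋-sym (⊕-cong 0∷[]≋[] (⊗-zeroʳ y))

    go : ∀ g h → comp g y ≋ comp h y → g ≋ h
    go []      []      e = ≋-refl
    go []      (b ∷ h) e with step [] (comp h y) (≋-trans (≋-sym []≋) e)
    ... | 0≈b , e′ = ≋-trans (≋-sym 0∷[]≋[]) (∷-cong 0≈b (go [] h e′))
    go (a ∷ g) []      e with step (comp g y) [] (≋-trans e []≋)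
    ... | a≈0 , e′ = ≋-trans (∷-cong a≈0 (go g [] e′)) 0∷[]≋[]
    go (a ∷ g) (b ∷ h) e with step (comp g y) (comp h y) e
    ... | a≈b , e′ = ∷-cong a≈b (go g h e′)

  IsL-∃! : ∀ {α} → ¬ α ≈ 0# → ∀ f → ∃! _≋_ (IsL α f)
  IsL-∃! {α} α≉0 f = scale α (part₁ α f) , IsL-exists α f , λ {g} isL →
    comp-injective α≉0 (scale α (part₁ α f)) g (≋-trans (IsL-exists α f) (≋-sym isL))

  L : ∀ α → ¬ α ≈ 0# → Poly → Poly
  L α α≉0 f = proj₁ (IsL-∃! α≉0 f)

  DistinctCriticalValues : Poly → Set (c ⊔ ℓ)
  DistinctCriticalValues g = ∀ τ η →
    eval (deriv g) τ ≈ 0# → eval (deriv g) η ≈ 0# → eval g τ ≈ eval g η → τ ≈ η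

{-# OPTIONS --safe #-}

-- Put n = m - 1 and g = L_α(x^m).  Write a point as τ = x(x + α) with x ≠ 0 and
-- set ζ = (x + α)/x, so that (1 + ζ) x = α.  The chain rule applied to
-- g(x(x + α)) = (x + α)^m + x^m gives α g'(τ) = (1 + ζ^n) x^n, so τ is critical iff
-- ζ^n = 1, and then g(τ) = α x^n.  For two critical points with parameters (x₁, ζ₁)
-- and (x₂, ζ₂), the values agree iff x₁^n = x₂^n, where x₂/x₁ = (1 + ζ₁)/(1 + ζ₂), and
-- the points agree iff x₁ = x₂ or x₁ = x₂ + α, that is, iff ζ₁ = ζ₂ or ζ₁ ζ₂ = 1.

module Submission where

open import Defs
open import Algebra.Bundles using (CommutativeSemiring)
open import Data.Fin.Base using (zero; suc)
open import Data.List.Base using ([]; _∷_)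
open import Data.Nat.Base as ℕ using (ℕ; zero; suc; _≤_; _∸_)
open import Data.Nat.Divisibility.Core using (_∣_; divides)
open import Data.Nat.DivMod using (result; _divMod_)
open import Data.Product using (∃; ∃₂; _×_; _,_; proj₁; proj₂)
open import Data.Sum.Base using (_⊎_; inj₁; inj₂; [_,_])
open import Function.Base using (_∘_)
open import Function.Bundles using (_⇔_; mk⇔; Equivalence)
open import Relation.Binary.PropositionalEquality.Core as ≡ using (_≡_)
open import Relation.Nullary.Decidable using (yes; no)
open import Relation.Nullary.Negation.Core using (¬_; contradiction)
import Algebra.Properties.CommutativeSemiring.Exp as Exp
import Algebra.Properties.Monoid.Mult as Mult
import Algebra.Solver.Ring.NaturalCoefficients.Default as NatSolver
import Relation.Binary.Reasoning.Setoid as SetoidReasoning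

-- With `m` in the form `suc (k * 2)`, the exponent `m ∸ 1` reduces to `k * 2`, the shape over which
-- derivatives of powers are computed by induction.
odd⇒1+2k : ∀ {m} → ¬ (2 ∣ m) → ∃ λ k → m ≡ suc (k ℕ.* 2)
odd⇒1+2k {m} 2∤m with m divMod 2
... | result k zero       m≡2k   = contradiction (divides k m≡2k) 2∤m
... | result k (suc zero) m≡1+2k = k , m≡1+2k

-- Evaluation of polynomials, compatible with the ring operations and composition.

module Evaluation {c ℓ} (S : CommutativeSemiring c ℓ) where

  open CommutativeSemiring S hiding (zero)
  open Polynomial S
  open Exp S using (_^_)
  open Mult +-monoid using (×-homo-1)
  open SetoidReasoning setoid
  private
    module S = NatSolver S
  open S using (_:+_; _:*_; _:=_; con)

  -- Equal polynomials may differ by trailing zeros, so congruence of evaluation needs the case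
  -- where one list has run out.
  eval-≋[] : ∀ p x → p ≋ [] → eval p x ≈ 0#
  eval-≋[] []      x e = refl
  eval-≋[] (a ∷ p) x e = begin
    a + x * eval p x  ≈⟨ +-cong (at e 0) (*-congˡ (eval-≋[] p x (mk≋ (at e ∘ suc)))) ⟩
    0# + x * 0#       ≈⟨ trans (+-identityˡ _) (zeroʳ x) ⟩
    0#                ∎

  eval-cong : ∀ p q x → p ≋ q → eval p x ≈ eval q x
  eval-cong []      q       x e = sym (eval-≋[] q x (≋-sym e))
  eval-cong (a ∷ p) []      x e = eval-≋[] (a ∷ p) x e
  eval-cong (a ∷ p) (b ∷ q) x e =
    +-cong (at e 0) (*-congˡ (eval-cong p q x (mk≋ (at e ∘ suc))))

  eval-congˡ : ∀ p {x z} → x ≈ z → eval p x ≈ eval p z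
  eval-congˡ []      e = refl
  eval-congˡ (a ∷ p) e = +-congˡ (*-cong e (eval-congˡ p e))

  eval-C : ∀ a x → eval (C a) x ≈ a
  eval-C a x = trans (+-congˡ (zeroʳ x)) (+-identityʳ a)

  eval-X : ∀ x → eval X x ≈ x
  eval-X x = trans (+-identityˡ _) (trans (*-congˡ (eval-C 1# x)) (*-identityʳ x))

  eval-⊕ : ∀ p q x → eval (p ⊕ q) x ≈ eval p x + eval q x
  eval-⊕ []      q       x = sym (+-identityˡ _)
  eval-⊕ (a ∷ p) []      x = sym (+-identityʳ _)
  eval-⊕ (a ∷ p) (b ∷ q) x = begin
    (a + b) + x * eval (p ⊕ q) x         ≈⟨ +-congˡ (*-congˡ (eval-⊕ p q x)) ⟩
    (a + b) + x * (eval p x + eval q x)  ≈⟨ S.solve 5 (λ a b x p q →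
      (a :+ b) :+ x :* (p :+ q) := (a :+ x :* p) :+ (b :+ x :* q)) refl a b x _ _ ⟩
    (a + x * eval p x) + (b + x * eval q x) ∎

  eval-scale : ∀ a p x → eval (scale a p) x ≈ a * eval p x
  eval-scale a []      x = sym (zeroʳ a)
  eval-scale a (b ∷ p) x = begin
    a * b + x * eval (scale a p) x  ≈⟨ +-congˡ (*-congˡ (eval-scale a p x)) ⟩
    a * b + x * (a * eval p x)      ≈⟨ S.solve 4 (λ a b x p →
      a :* b :+ x :* (a :* p) := a :* (b :+ x :* p)) refl a b x _ ⟩
    a * (b + x * eval p x)          ∎

  eval-⊗ : ∀ p q x → eval (p ⊗ q) x ≈ eval p x * eval q x
  eval-⊗ []      q x = sym (zeroˡ _)
  eval-⊗ (a ∷ p) q x = begin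
    eval (scale a q ⊕ (0# ∷ p ⊗ q)) x
      ≈⟨ eval-⊕ (scale a q) _ x ⟩
    eval (scale a q) x + (0# + x * eval (p ⊗ q) x)
      ≈⟨ +-cong (eval-scale a q x) (+-congˡ (*-congˡ (eval-⊗ p q x))) ⟩
    a * eval q x + (0# + x * (eval p x * eval q x))
      ≈⟨ S.solve 4 (λ a x p q → a :* q :+ (con 0 :+ x :* (p :* q)) := (a :+ x :* p) :* q)
           refl a x _ _ ⟩
    (a + x * eval p x) * eval q x ∎

  eval-^ : ∀ p n x → eval (p ^ᴾ n) x ≈ eval p x ^ n
  eval-^ p zero    x = eval-C 1# x
  eval-^ p (suc n) x = trans (eval-⊗ p (p ^ᴾ n) x) (*-congˡ (eval-^ p n x))

  eval-comp : ∀ p q x → eval (comp p q) x ≈ eval p (eval q x)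
  eval-comp []      q x = refl
  eval-comp (a ∷ p) q x = begin
    eval (C a ⊕ q ⊗ comp p q) x              ≈⟨ eval-⊕ (C a) (q ⊗ comp p q) x ⟩
    eval (C a) x + eval (q ⊗ comp p q) x     ≈⟨ +-cong (eval-C a x) (eval-⊗ q (comp p q) x) ⟩
    a + eval q x * eval (comp p q) x         ≈⟨ +-congˡ (*-congˡ (eval-comp p q x)) ⟩
    a + eval q x * eval p (eval q x)         ∎

  -- Formal derivatives at a point: Leibniz and chain rules.

  eval′ : Poly → Carrier → Carrier
  eval′ p = eval (deriv p)

  -- Coefficientwise this is `(k + 1) a = a + k a`. For `k = 0` it compares the multipliers 1, 2,
  -- ... of a derivative with 0, 1, ..., and the latter give `x` times the derivative.
  eval-derivFrom : ∀ k p x → eval (derivFrom (suc k) p) x ≈ eval p x + eval (derivFrom k p) x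
  eval-derivFrom k []      x = sym (+-identityʳ 0#)
  eval-derivFrom k (a ∷ p) x =
    trans (+-congˡ (*-congˡ (eval-derivFrom (suc k) p x)))
    (S.solve 5 (λ a b x p q → (a :+ b) :+ x :* (p :+ q) := (a :+ x :* p) :+ (b :+ x :* q))
       refl a _ x _ _)

  -- This is the Leibniz rule for `a + X p`; it drives the inductions for `⊕`, `scale`, `⊗` and
  -- `comp`.
  eval′-∷ : ∀ a p x → eval′ (a ∷ p) x ≈ eval p x + x * eval′ p x
  eval′-∷ a p x = trans (eval-derivFrom 0 p x) (+-congˡ (rest p))
    where
    rest : ∀ p → eval (derivFrom 0 p) x ≈ x * eval′ p x
    rest []      = sym (zeroʳ x)
    rest (b ∷ p) = +-identityˡ _

  derivFrom-cong : ∀ k {p q} → p ≋ q → derivFrom k p ≋ derivFrom k q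
  derivFrom-cong k {p} {q} e = mk≋ λ n → go k p q n e
    where
    open Mult +-monoid using (×-congʳ) renaming (_×_ to _·_)
    vanish : ∀ k → 0# ≈ k · 0#
    vanish zero    = refl
    vanish (suc k) = trans (vanish k) (sym (+-identityˡ _))
    go : ∀ k p q n → p ≋ q → coeff (derivFrom k p) n ≈ coeff (derivFrom k q) n
    go k []      []      n       e = refl
    go k []      (b ∷ q) zero    e = trans (vanish k) (×-congʳ k (at e 0))
    go k []      (b ∷ q) (suc n) e = go (suc k) [] q n (mk≋ (at e ∘ suc))
    go k (a ∷ p) []      zero    e = trans (×-congʳ k (at e 0)) (sym (vanish k))
    go k (a ∷ p) []      (suc n) e = go (suc k) p [] n (mk≋ (at e ∘ suc))
    go k (a ∷ p) (b ∷ q) zero    e = ×-congʳ k (at e 0)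
    go k (a ∷ p) (b ∷ q) (suc n) e = go (suc k) p q n (mk≋ (at e ∘ suc))

  eval′-≋[] : ∀ p x → p ≋ [] → eval′ p x ≈ 0#
  eval′-≋[] []      x e = refl
  eval′-≋[] (a ∷ p) x e = eval-≋[] _ x (derivFrom-cong 1 {p} {[]} (mk≋ (at e ∘ suc)))

  eval′-cong : ∀ p q x → p ≋ q → eval′ p x ≈ eval′ q x
  eval′-cong []      q       x e = sym (eval′-≋[] q x (≋-sym e))
  eval′-cong (a ∷ p) []      x e = eval′-≋[] (a ∷ p) x e
  eval′-cong (a ∷ p) (b ∷ q) x e =
    eval-cong (deriv (a ∷ p)) (deriv (b ∷ q)) x (derivFrom-cong 1 {p} {q} (mk≋ (at e ∘ suc)))

  eval′-X : ∀ x → eval′ X x ≈ 1#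
  eval′-X x = trans (eval-C _ x) (×-homo-1 1#)

  eval′-⊕ : ∀ p q x → eval′ (p ⊕ q) x ≈ eval′ p x + eval′ q x
  eval′-⊕ []      q       x = sym (+-identityˡ _)
  eval′-⊕ (a ∷ p) []      x = sym (+-identityʳ _)
  eval′-⊕ (a ∷ p) (b ∷ q) x = begin
    eval′ (a + b ∷ p ⊕ q) x
      ≈⟨ eval′-∷ (a + b) (p ⊕ q) x ⟩
    eval (p ⊕ q) x + x * eval′ (p ⊕ q) x
      ≈⟨ +-cong (eval-⊕ p q x) (*-congˡ (eval′-⊕ p q x)) ⟩
    (eval p x + eval q x) + x * (eval′ p x + eval′ q x)
      ≈⟨ S.solve 5 (λ a b x p q → (a :+ b) :+ x :* (p :+ q) := (a :+ x :* p) :+ (b :+ x :* q))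
           refl _ _ x _ _ ⟩
    (eval p x + x * eval′ p x) + (eval q x + x * eval′ q x)
      ≈⟨ +-cong (sym (eval′-∷ a p x)) (sym (eval′-∷ b q x)) ⟩
    eval′ (a ∷ p) x + eval′ (b ∷ q) x ∎

  eval′-scale : ∀ a p x → eval′ (scale a p) x ≈ a * eval′ p x
  eval′-scale a []      x = sym (zeroʳ a)
  eval′-scale a (b ∷ p) x = begin
    eval′ (a * b ∷ scale a p) x
      ≈⟨ eval′-∷ (a * b) (scale a p) x ⟩
    eval (scale a p) x + x * eval′ (scale a p) x
      ≈⟨ +-cong (eval-scale a p x) (*-congˡ (eval′-scale a p x)) ⟩
    a * eval p x + x * (a * eval′ p x)
      ≈⟨ S.solve 4 (λ a x p q → a :* p :+ x :* (a :* q) := a :* (p :+ x :* q)) refl a x _ _ ⟩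
    a * (eval p x + x * eval′ p x)
      ≈⟨ *-congˡ (sym (eval′-∷ b p x)) ⟩
    a * eval′ (b ∷ p) x ∎

  eval′-⊗ : ∀ p q x → eval′ (p ⊗ q) x ≈ eval′ p x * eval q x + eval p x * eval′ q x
  eval′-⊗ []      q x = sym (trans (+-cong (zeroˡ _) (zeroˡ _)) (+-identityʳ 0#))
  eval′-⊗ (a ∷ p) q x = begin
    eval′ (scale a q ⊕ (0# ∷ p ⊗ q)) x
      ≈⟨ eval′-⊕ (scale a q) _ x ⟩
    eval′ (scale a q) x + eval′ (0# ∷ p ⊗ q) x
      ≈⟨ +-cong (eval′-scale a q x) (eval′-∷ 0# (p ⊗ q) x) ⟩
    a * eval′ q x + (eval (p ⊗ q) x + x * eval′ (p ⊗ q) x)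
      ≈⟨ +-congˡ (+-cong (eval-⊗ p q x) (*-congˡ (eval′-⊗ p q x))) ⟩
    a * eval′ q x + (eval p x * eval q x + x * (eval′ p x * eval q x + eval p x * eval′ q x))
      ≈⟨ S.solve 6 (λ a x p p′ q q′ → a :* q′ :+ (p :* q :+ x :* (p′ :* q :+ p :* q′))
                                    := (p :+ x :* p′) :* q :+ (a :+ x :* p) :* q′)
           refl a x _ _ _ _ ⟩
    (eval p x + x * eval′ p x) * eval q x + (a + x * eval p x) * eval′ q x
      ≈⟨ +-congʳ (*-congʳ (sym (eval′-∷ a p x))) ⟩
    eval′ (a ∷ p) x * eval q x + eval (a ∷ p) x * eval′ q x ∎

  eval′-comp : ∀ p q x → eval′ (comp p q) x ≈ eval′ p (eval q x) * eval′ q x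
  eval′-comp []      q x = sym (zeroˡ _)
  eval′-comp (a ∷ p) q x = begin
    eval′ (C a ⊕ q ⊗ comp p q) x
      ≈⟨ eval′-⊕ (C a) (q ⊗ comp p q) x ⟩
    0# + eval′ (q ⊗ comp p q) x
      ≈⟨ trans (+-identityˡ _) (eval′-⊗ q (comp p q) x) ⟩
    eval′ q x * eval (comp p q) x + y * eval′ (comp p q) x
      ≈⟨ +-cong (*-congˡ (eval-comp p q x)) (*-congˡ (eval′-comp p q x)) ⟩
    eval′ q x * eval p y + y * (eval′ p y * eval′ q x)
      ≈⟨ S.solve 4 (λ p p′ q′ y → q′ :* p :+ y :* (p′ :* q′) := (p :+ y :* p′) :* q′)
           refl _ _ _ y ⟩
    (eval p y + y * eval′ p y) * eval′ q x
      ≈⟨ *-congʳ (sym (eval′-∷ a p y)) ⟩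
    eval′ (a ∷ p) y * eval′ q x ∎
    where
    y = eval q x

-- Cancellation and powers in a field with decidable equality.

module DiscreteFieldProperties {c ℓ} (F : DiscreteField c ℓ) where

  open DiscreteField F hiding (zero)
  open Exp commutativeSemiring using (^-congˡ; ^-distrib-*)
  open SetoidReasoning setoid

  *-cancelˡ : ∀ {a x y} → ¬ a ≈ 0# → a * x ≈ a * y → x ≈ y
  *-cancelˡ {a} {x} {y} a≉0 e = trans (sym (undo x)) (trans (*-congˡ e) (undo y))
    where
    undo : ∀ z → a ⁻¹ * (a * z) ≈ z
    undo z = begin
      a ⁻¹ * (a * z)  ≈⟨ sym (*-assoc _ a z) ⟩
      a ⁻¹ * a * z    ≈⟨ *-congʳ (trans (*-comm _ a) (*-inverse a≉0)) ⟩
      1# * z          ≈⟨ *-identityˡ z ⟩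
      z               ∎

  *-cancelʳ : ∀ {a x y} → ¬ a ≈ 0# → x * a ≈ y * a → x ≈ y
  *-cancelʳ a≉0 e = *-cancelˡ a≉0 (trans (*-comm _ _) (trans e (*-comm _ _)))

  *≈0 : ∀ {x y} → x * y ≈ 0# → x ≈ 0# ⊎ y ≈ 0#
  *≈0 {x} e with x ≟ 0#
  ... | yes x≈0 = inj₁ x≈0
  ... | no  x≉0 = inj₂ (*-cancelˡ x≉0 (trans e (sym (zeroʳ x))))

  ^≈0 : ∀ x n → x ^ n ≈ 0# → x ≈ 0#
  ^≈0 x zero    e = contradiction e 1≉0
  ^≈0 x (suc n) e with *≈0 e
  ... | inj₁ x≈0  = x≈0
  ... | inj₂ xⁿ≈0 = ^≈0 x n xⁿ≈0

  /-*-cancel : ∀ {x y} → ¬ y ≈ 0# → x / y * y ≈ x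
  /-*-cancel {x} {y} y≉0 = begin
    x * y ⁻¹ * y    ≈⟨ *-assoc x _ y ⟩
    x * (y ⁻¹ * y)  ≈⟨ *-congˡ (trans (*-comm _ y) (*-inverse y≉0)) ⟩
    x * 1#          ≈⟨ *-identityʳ x ⟩
    x               ∎

  -- Here `r ^ n * x ^ n = y ^ n`, and `x ^ n` cancels because `x` is nonzero. It serves twice: with
  -- `r = ζ` and `y = x + α` for criticality, and with `r` the ratio of `1 + ζ₁` to `1 + ζ₂` for
  -- equality of critical values.
  r^n≈1⇔x^n≈y^n : ∀ {r x y} n → ¬ x ≈ 0# → r * x ≈ y → r ^ n ≈ 1# ⇔ x ^ n ≈ y ^ n
  r^n≈1⇔x^n≈y^n {r} {x} {y} n x≉0 rx≈y = mk⇔ to from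
    where
    rⁿxⁿ : r ^ n * x ^ n ≈ y ^ n
    rⁿxⁿ = trans (sym (^-distrib-* r x n)) (^-congˡ n rx≈y)

    to : r ^ n ≈ 1# → x ^ n ≈ y ^ n
    to e = trans (sym (*-identityˡ _)) (trans (*-congʳ (sym e)) rⁿxⁿ)

    from : x ^ n ≈ y ^ n → r ^ n ≈ 1#
    from e = *-cancelʳ (x≉0 ∘ ^≈0 x n) (trans rⁿxⁿ (trans (sym e) (sym (*-identityˡ _))))

-- Characteristic 2 and derivatives of powers of `X`.

module CriticalPoints {c ℓ} (K : AlgebraicClosureOf𝔽₂ c ℓ) where

  open AlgebraicClosureOf𝔽₂ K hiding (zero)
  open DerivativeReduction K
  open Evaluation commutativeSemiring
  open DiscreteFieldProperties discreteField
  open Exp commutativeSemiring using (^-congˡ)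
  open SetoidReasoning setoid
  private
    module S = NatSolver commutativeSemiring
  open S using (_:+_; _:*_; _:=_; con)

  x+x≈0 : ∀ x → x + x ≈ 0#
  x+x≈0 x = begin
    x + x         ≈⟨ S.solve 1 (λ x → x :+ x := x :* (con 1 :+ con 1)) refl x ⟩
    x * (1# + 1#) ≈⟨ *-congˡ char2 ⟩
    x * 0#        ≈⟨ zeroʳ x ⟩
    0#            ∎

  ≈⇒+≈0 : ∀ {x y} → x ≈ y → x + y ≈ 0#
  ≈⇒+≈0 {x} {y} e = trans (+-congʳ e) (x+x≈0 y)

  x+y+y≈x : ∀ x y → x + y + y ≈ x
  x+y+y≈x x y = trans (+-assoc x y y) (trans (+-congˡ (x+x≈0 y)) (+-identityʳ x))

  +≈0⇒≈ : ∀ {x y} → x + y ≈ 0# → x ≈ y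
  +≈0⇒≈ {x} {y} e = trans (sym (x+y+y≈x x y)) (trans (+-congʳ e) (+-identityˡ y))

  -- The two parities are proved by mutual induction through `eval′-X^suc`. From an odd exponent to
  -- the next even one, two equal terms appear and cancel in characteristic 2; from an even exponent
  -- to the next odd one, only the pure power survives.
  eval′-X^2k : ∀ k x → eval′ (X ^ᴾ (k ℕ.* 2)) x ≈ 0#
  eval′-X^1+2k : ∀ k x → eval′ (X ^ᴾ suc (k ℕ.* 2)) x ≈ x ^ (k ℕ.* 2)

  eval′-X^suc : ∀ n x → eval′ (X ^ᴾ suc n) x ≈ x ^ n + x * eval′ (X ^ᴾ n) x
  eval′-X^suc n x = begin
    eval′ (X ⊗ X ^ᴾ n) x
      ≈⟨ eval′-⊗ X (X ^ᴾ n) x ⟩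
    eval′ X x * eval (X ^ᴾ n) x + eval X x * eval′ (X ^ᴾ n) x
      ≈⟨ +-cong (*-cong (eval′-X x) (trans (eval-^ X n x) (^-congˡ n (eval-X x))))
                (*-congʳ (eval-X x)) ⟩
    1# * x ^ n + x * eval′ (X ^ᴾ n) x
      ≈⟨ +-congʳ (*-identityˡ _) ⟩
    x ^ n + x * eval′ (X ^ᴾ n) x ∎

  eval′-X^2k zero    x = refl
  eval′-X^2k (suc k) x =
    trans (eval′-X^suc (suc (k ℕ.* 2)) x) (≈⇒+≈0 (*-congˡ (sym (eval′-X^1+2k k x))))

  eval′-X^1+2k k x = begin
    eval′ (X ^ᴾ suc (k ℕ.* 2)) x                    ≈⟨ eval′-X^suc (k ℕ.* 2) x ⟩
    x ^ (k ℕ.* 2) + x * eval′ (X ^ᴾ (k ℕ.* 2)) x    ≈⟨ +-congˡ (*-congˡ (eval′-X^2k k x)) ⟩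
    x ^ (k ℕ.* 2) + x * 0#                          ≈⟨ trans (+-congˡ (zeroʳ x)) (+-identityʳ _) ⟩
    x ^ (k ℕ.* 2)                                   ∎

  -- The substitution `x (x + α)` and the polynomial `L`.

  module _ {α : Carrier} (α≉0 : ¬ α ≈ 0#) where

    x[x+α]-surjective : ∀ τ → ∃ λ x → x * (x + α) ≈ τ
    -- The polynomial is `τ + α X + X²`. Since `closed` inspects the coefficient of index `suc n`,
    -- the witness 1 points at the leading coefficient.
    x[x+α]-surjective τ with closed (τ ∷ α ∷ 1# ∷ []) (1 , 1≉0)
    ... | x , e = x , sym (+≈0⇒≈ (trans (+-congˡ (S.solve 2
      (λ x a → x :* (x :+ a) := x :* (a :+ x :* (con 1 :+ x :* con 0))) refl x α)) e))

    module _ (f g : Poly) (isL : IsL α f g) where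

      private
        s y : Poly
        s = X ⊕ C α
        y = X ⊗ s

        eval-s : ∀ x → eval s x ≈ x + α
        eval-s x = trans (eval-⊕ X (C α) x) (+-cong (eval-X x) (eval-C α x))

        eval-y : ∀ x → eval y x ≈ x * (x + α)
        eval-y x = trans (eval-⊗ X s x) (*-cong (eval-X x) (eval-s x))

        eval′-s : ∀ x → eval′ s x ≈ 1#
        eval′-s x = trans (eval′-⊕ X (C α) x) (trans (+-identityʳ _) (eval′-X x))

        -- The derivative of `X²` vanishes in characteristic 2, leaving that of `α X`. As this
        -- constant is nonzero, criticality of `g` at `x (x + α)` can be read off from the right
        -- side of `eval′-L`.
        eval′-y : ∀ x → eval′ y x ≈ α
        eval′-y x = begin
          eval′ y x
            ≈⟨ eval′-⊗ X s x ⟩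
          eval′ X x * eval s x + eval X x * eval′ s x
            ≈⟨ +-cong (*-cong (eval′-X x) (eval-s x)) (*-cong (eval-X x) (eval′-s x)) ⟩
          1# * (x + α) + x * 1#
            ≈⟨ S.solve 2 (λ x a → con 1 :* (x :+ a) :+ x :* con 1 := (a :+ x) :+ x) refl x α ⟩
          α + x + x
            ≈⟨ x+y+y≈x α x ⟩
          α ∎

      eval-L : ∀ x → eval g (x * (x + α)) ≈ eval f (x + α) + eval f x
      eval-L x = begin
        eval g (x * (x + α))      ≈⟨ eval-congˡ g (sym (eval-y x)) ⟩
        eval g (eval y x)         ≈⟨ sym (eval-comp g y x) ⟩
        eval (comp g y) x         ≈⟨ eval-cong (comp g y) (D α f) x isL ⟩
        eval (D α f) x            ≈⟨ eval-⊕ (comp f s) f x ⟩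
        eval (comp f s) x + eval f x
          ≈⟨ +-congʳ (trans (eval-comp f s x) (eval-congˡ f (eval-s x))) ⟩
        eval f (x + α) + eval f x ∎

      -- The chain rule is applied to both sides of `comp g y ≋ D α f`.
      eval′-L : ∀ x → eval′ g (x * (x + α)) * α ≈ eval′ f (x + α) + eval′ f x
      eval′-L x = begin
        eval′ g (x * (x + α)) * α
          ≈⟨ *-cong (eval-congˡ (deriv g) (sym (eval-y x))) (sym (eval′-y x)) ⟩
        eval′ g (eval y x) * eval′ y x  ≈⟨ sym (eval′-comp g y x) ⟩
        eval′ (comp g y) x              ≈⟨ eval′-cong (comp g y) (D α f) x isL ⟩
        eval′ (D α f) x                 ≈⟨ eval′-⊕ (comp f s) f x ⟩
        eval′ (comp f s) x + eval′ f x
          ≈⟨ +-congʳ (trans (eval′-comp f s x)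
               (trans (*-cong (eval-congˡ (deriv f) (eval-s x)) (eval′-s x)) (*-identityʳ _))) ⟩
        eval′ f (x + α) + eval′ f x ∎

    -- Division-free form of `ζ = (x + α) / x`. As `α` is nonzero, it forces `x ≠ 0` and `ζ ≠ 1`;
    -- under these restrictions each of `x` and `ζ` determines the other.
    Parameter : Carrier → Carrier → Set ℓ
    Parameter x ζ = (1# + ζ) * x ≈ α

    parameter≉0 : ∀ {x ζ} → Parameter x ζ → ¬ x ≈ 0#
    parameter≉0 e x≈0 = α≉0 (trans (sym e) (trans (*-congˡ x≈0) (zeroʳ _)))

    1+ζ≉0 : ∀ {x ζ} → Parameter x ζ → ¬ 1# + ζ ≈ 0#
    1+ζ≉0 e 1+ζ≈0 = α≉0 (trans (sym e) (trans (*-congʳ 1+ζ≈0) (zeroˡ _)))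

    ζ≉1 : ∀ {x ζ} → Parameter x ζ → ¬ ζ ≈ 1#
    ζ≉1 e ζ≈1 = 1+ζ≉0 e (≈⇒+≈0 (sym ζ≈1))

    ζx≈x+α : ∀ {x ζ} → Parameter x ζ → ζ * x ≈ x + α
    ζx≈x+α {x} {ζ} e = begin
      ζ * x                  ≈⟨ sym (x+y+y≈x _ x) ⟩
      ζ * x + x + x          ≈⟨ S.solve 2 (λ z x → z :* x :+ x :+ x := x :+ (con 1 :+ z) :* x)
                                  refl ζ x ⟩
      x + (1# + ζ) * x       ≈⟨ +-congˡ e ⟩
      x + α                  ∎

    ζ⇒parameter : ∀ ζ → ¬ ζ ≈ 1# → ∃ λ x → Parameter x ζ
    ζ⇒parameter ζ ζ≉1 = α / (1# + ζ) , trans (*-comm _ _) (/-*-cancel (ζ≉1 ∘ sym ∘ +≈0⇒≈))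

    x⇒parameter : ∀ x → ¬ x ≈ 0# → ∃ λ ζ → Parameter x ζ
    x⇒parameter x x≉0 = (x + α) / x , (begin
      (1# + (x + α) / x) * x      ≈⟨ distribʳ x _ _ ⟩
      1# * x + (x + α) / x * x    ≈⟨ +-cong (*-identityˡ x) (/-*-cancel x≉0) ⟩
      x + (x + α)                 ≈⟨ S.solve 2 (λ x a → x :+ (x :+ a) := (a :+ x) :+ x) refl x α ⟩
      α + x + x                   ≈⟨ x+y+y≈x α x ⟩
      α                           ∎)

    -- Two parametrized points: their ratio and their coincidence.

    module _ {x₁ x₂ ζ₁ ζ₂ : Carrier} (e₁ : Parameter x₁ ζ₁) (e₂ : Parameter x₂ ζ₂) where

      private
        x₁≉0 = parameter≉0 e₁
        x₂≉0 = parameter≉0 e₂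

      -- Both `(1 + ζ₁) x₁` and `(1 + ζ₂) x₂` equal `α`.
      ratio-parameter : (1# + ζ₁) / (1# + ζ₂) * x₁ ≈ x₂
      ratio-parameter = *-cancelˡ (1+ζ≉0 e₂) (begin
        (1# + ζ₂) * ((1# + ζ₁) / (1# + ζ₂) * x₁)
          ≈⟨ S.solve 3 (λ a r x → a :* (r :* x) := r :* a :* x) refl _ _ _ ⟩
        (1# + ζ₁) / (1# + ζ₂) * (1# + ζ₂) * x₁  ≈⟨ *-congʳ (/-*-cancel (1+ζ≉0 e₂)) ⟩
        (1# + ζ₁) * x₁                          ≈⟨ trans e₁ (sym e₂) ⟩
        (1# + ζ₂) * x₂                          ∎)

      -- The cross terms `x₁ x₂` cancel in pairs. The factorization shows that `x₂` and `x₂ + α` are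
      -- the only preimages of `x₂ (x₂ + α)`.
      [x₁+x₂][x₁+x₂+α] : (x₁ + x₂) * (x₁ + (x₂ + α)) ≈ x₁ * (x₁ + α) + x₂ * (x₂ + α)
      [x₁+x₂][x₁+x₂+α] = trans
        (S.solve 3 (λ x z a → (x :+ z) :* (x :+ (z :+ a))
                            := (x :* (x :+ a) :+ z :* (z :+ a)) :+ x :* z :+ x :* z) refl x₁ x₂ α)
        (x+y+y≈x _ _)

      same-point⇒ : x₁ * (x₁ + α) ≈ x₂ * (x₂ + α) → ζ₁ ≈ ζ₂ ⊎ ζ₁ ≈ ζ₂ ⁻¹
      same-point⇒ e with *≈0 (trans [x₁+x₂][x₁+x₂+α] (≈⇒+≈0 e))
      ... | inj₁ d = inj₁ (*-cancelʳ x₁≉0 (begin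
        ζ₁ * x₁  ≈⟨ ζx≈x+α e₁ ⟩
        x₁ + α   ≈⟨ +-congʳ (+≈0⇒≈ d) ⟩
        x₂ + α   ≈⟨ sym (ζx≈x+α e₂) ⟩
        ζ₂ * x₂  ≈⟨ *-congˡ (sym (+≈0⇒≈ d)) ⟩
        ζ₂ * x₁  ∎))
      -- Here `x₁ = x₂ + α`. Adding `α` swaps numerator and denominator of `(x + α) / x`, so
      -- `ζ₁ ζ₂ = 1`. Hence `ζ₂` is nonzero and `ζ₂ ⁻¹` is a true inverse, not the placeholder at 0.
      ... | inj₂ d = inj₂ (*-cancelʳ ζ₂≉0 (trans ζ₁ζ₂≈1
        (sym (trans (*-comm _ _) (*-inverse ζ₂≉0)))))
        where
        ζ₁ζ₂≈1 : ζ₁ * ζ₂ ≈ 1#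
        ζ₁ζ₂≈1 = *-cancelʳ x₂≉0 (begin
          ζ₁ * ζ₂ * x₂    ≈⟨ *-assoc ζ₁ ζ₂ x₂ ⟩
          ζ₁ * (ζ₂ * x₂)  ≈⟨ *-congˡ (trans (ζx≈x+α e₂) (sym (+≈0⇒≈ d))) ⟩
          ζ₁ * x₁         ≈⟨ ζx≈x+α e₁ ⟩
          x₁ + α          ≈⟨ +-congʳ (+≈0⇒≈ d) ⟩
          x₂ + α + α      ≈⟨ x+y+y≈x x₂ α ⟩
          x₂              ≈⟨ sym (*-identityˡ x₂) ⟩
          1# * x₂         ∎)

        ζ₂≉0 : ¬ ζ₂ ≈ 0#
        ζ₂≉0 ζ₂≈0 = 1≉0 (trans (sym ζ₁ζ₂≈1) (trans (*-congˡ ζ₂≈0) (zeroʳ ζ₁)))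

      ζ₁≈ζ₂⇒same-point : ζ₁ ≈ ζ₂ → x₁ * (x₁ + α) ≈ x₂ * (x₂ + α)
      ζ₁≈ζ₂⇒same-point ζ₁≈ζ₂ = *-cong x₁≈x₂ (+-congʳ x₁≈x₂)
        where
        x₁≈x₂ : x₁ ≈ x₂
        x₁≈x₂ = *-cancelˡ (1+ζ≉0 e₁) (trans e₁ (trans (sym e₂) (*-congʳ (+-congˡ (sym ζ₁≈ζ₂)))))

      ζ₁≈ζ₂⁻¹⇒same-point : ζ₁ ≈ ζ₂ ⁻¹ → x₁ * (x₁ + α) ≈ x₂ * (x₂ + α)
      ζ₁≈ζ₂⁻¹⇒same-point ζ₁≈ζ₂⁻¹ with ζ₂ ≟ 0#
      -- Since 0⁻¹ = 0, the hypothesis reads ζ₁ = ζ₂ when ζ₂ = 0.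
      ... | yes ζ₂≈0 = ζ₁≈ζ₂⇒same-point
        (trans ζ₁≈ζ₂⁻¹ (trans (⁻¹-cong ζ₂≈0) (trans 0⁻¹ (sym ζ₂≈0))))
      ... | no  ζ₂≉0 = +≈0⇒≈ (begin
        x₁ * (x₁ + α) + x₂ * (x₂ + α)    ≈⟨ sym [x₁+x₂][x₁+x₂+α] ⟩
        (x₁ + x₂) * (x₁ + (x₂ + α))      ≈⟨ *-congˡ (≈⇒+≈0 x₁≈x₂+α) ⟩
        (x₁ + x₂) * 0#                   ≈⟨ zeroʳ _ ⟩
        0#                               ∎)
        where
        ζ₂ζ₁≈1 : ζ₂ * ζ₁ ≈ 1#
        ζ₂ζ₁≈1 = trans (*-congˡ ζ₁≈ζ₂⁻¹) (*-inverse ζ₂≉0)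

        x₁≈x₂+α : x₁ ≈ x₂ + α
        -- Writing 1 as `ζ₂ ζ₁` turns `1 + ζ₂` into `ζ₂ (1 + ζ₁)`; cancelling `1 + ζ₁` leaves
        -- `x₁ = ζ₂ x₂`.
        x₁≈x₂+α = trans (*-cancelˡ (1+ζ≉0 e₁) (begin
          (1# + ζ₁) * x₁           ≈⟨ trans e₁ (sym e₂) ⟩
          (1# + ζ₂) * x₂           ≈⟨ *-congʳ (+-congʳ (sym ζ₂ζ₁≈1)) ⟩
          (ζ₂ * ζ₁ + ζ₂) * x₂      ≈⟨ S.solve 3 (λ z w x → (z :* w :+ z) :* x
                                        := (con 1 :+ w) :* (z :* x)) refl ζ₂ ζ₁ x₂ ⟩
          (1# + ζ₁) * (ζ₂ * x₂)    ∎)) (ζx≈x+α e₂)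

    -- Critical points and critical values of `L` of an odd power.

    module _ (k : ℕ) where

      private
        n = k ℕ.* 2
        xⁿ⁺¹ = X ^ᴾ suc n
        g = L α α≉0 xⁿ⁺¹

        isL : IsL α xⁿ⁺¹ g
        -- `L` is the first component of `IsL-∃!`, so it unfolds to the polynomial that `IsL-exists`
        -- treats.
        isL = IsL-exists α xⁿ⁺¹

        eval-X^ : ∀ n x → eval (X ^ᴾ n) x ≈ x ^ n
        eval-X^ n x = trans (eval-^ X n x) (^-congˡ n (eval-X x))

      -- Since `n` is even, `α` times the derivative of `g` is `(x + α) ^ n + x ^ n`. The factor `α`
      -- cancels, and in characteristic 2 a sum vanishes exactly when its terms agree.
      critical-condition : ∀ x → eval′ g (x * (x + α)) ≈ 0# ⇔ (x + α) ^ n ≈ x ^ n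
      critical-condition x = mk⇔
        (λ e → +≈0⇒≈ (trans (sym eq) (trans (*-congʳ e) (zeroˡ α))))
        (λ e → *-cancelʳ α≉0 (trans eq (trans (≈⇒+≈0 e) (sym (zeroˡ α)))))
        where
        eq : eval′ g (x * (x + α)) * α ≈ (x + α) ^ n + x ^ n
        eq = trans (eval′-L xⁿ⁺¹ g isL x) (+-cong (eval′-X^1+2k k (x + α)) (eval′-X^1+2k k x))

      -- Criticality makes `x ^ n` a common factor of both summands, and `(x + α) + x = α`.
      critical-value : ∀ x → eval′ g (x * (x + α)) ≈ 0# → eval g (x * (x + α)) ≈ α * x ^ n
      critical-value x crit = begin
        eval g (x * (x + α))
          ≈⟨ eval-L xⁿ⁺¹ g isL x ⟩
        eval (X ^ᴾ suc n) (x + α) + eval (X ^ᴾ suc n) x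
          ≈⟨ +-cong (eval-X^ (suc n) (x + α)) (eval-X^ (suc n) x) ⟩
        (x + α) * (x + α) ^ n + x * x ^ n
          ≈⟨ +-congʳ (*-congˡ (Equivalence.to (critical-condition x) crit)) ⟩
        (x + α) * x ^ n + x * x ^ n
          ≈⟨ S.solve 3 (λ x a p → (x :+ a) :* p :+ x :* p := a :* p :+ x :* p :+ x :* p)
               refl x α _ ⟩
        α * x ^ n + x * x ^ n + x * x ^ n
          ≈⟨ x+y+y≈x _ _ ⟩
        α * x ^ n ∎

      critical⇔ζ^n≈1 : ∀ {x ζ} → Parameter x ζ → ζ ^ n ≈ 1# ⇔ eval′ g (x * (x + α)) ≈ 0#
      critical⇔ζ^n≈1 {x} e = mk⇔
        (from (critical-condition x) ∘ sym ∘ to root)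
        (from root ∘ sym ∘ to (critical-condition x))
        where
        open Equivalence
        root = r^n≈1⇔x^n≈y^n n (parameter≉0 e) (ζx≈x+α e)

    -- A preimage `x = 0` of a critical point would give `α ^ n = 0 ^ n`. The exponent is built from
    -- `suc k`, so `0 ^ n = 0` and `α` would vanish.
    critical⇒parameter : ∀ k {τ} → eval′ (L α α≉0 (X ^ᴾ suc (suc k ℕ.* 2))) τ ≈ 0# →
                         ∃₂ λ x ζ → Parameter x ζ × x * (x + α) ≈ τ
    critical⇒parameter k {τ} crit with x[x+α]-surjective τ
    ... | x , e = x , proj₁ (x⇒parameter x x≉0) , proj₂ (x⇒parameter x x≉0) , e
      where
      n = suc k ℕ.* 2
      g = L α α≉0 (X ^ᴾ suc n)

      x≉0 : ¬ x ≈ 0#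
      x≉0 x≈0 = α≉0 (begin
        α       ≈⟨ sym (+-identityˡ α) ⟩
        0# + α  ≈⟨ +-congʳ (sym x≈0) ⟩
        x + α   ≈⟨ ^≈0 (x + α) n (begin
          (x + α) ^ n  ≈⟨ Equivalence.to (critical-condition (suc k) x)
                            (trans (eval-congˡ (deriv g) e) crit) ⟩
          x ^ n        ≈⟨ *-congʳ x≈0 ⟩
          0# * _       ≈⟨ zeroˡ _ ⟩
          0#           ∎) ⟩
        0#      ∎)

proposition3p11 : ∀ {c ℓ} (K : AlgebraicClosureOf𝔽₂ c ℓ) →
    let open AlgebraicClosureOf𝔽₂ K
        open DerivativeReduction K in
    (m : ℕ) → 7 ≤ m → ¬ (2 ∣ m) →
    (α : Carrier) (α≉0 : ¬ (α ≈ 0#)) →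
    DistinctCriticalValues (L α α≉0 (X ^ᴾ m))
      ⇔
    ((ζ₁ ζ₂ : Carrier) → ¬ (ζ₁ ≈ 1#) → ¬ (ζ₂ ≈ 1#) →
      ζ₁ ^ (m ∸ 1) ≈ 1# →
      ζ₂ ^ (m ∸ 1) ≈ 1# →
      ((1# + ζ₁) / (1# + ζ₂)) ^ (m ∸ 1) ≈ 1# →
      (ζ₁ ≈ ζ₂) ⊎ (ζ₁ ≈ ζ₂ ⁻¹))
proposition3p11 K m 7≤m 2∤m α α≉0 with odd⇒1+2k 2∤m
-- This case is `m = 1`, excluded by `7 ≤ m`; in the next one the exponent `n` is positive.
proposition3p11 K _ (ℕ.s≤s ()) _ α α≉0 | zero , ≡.refl
proposition3p11 K _ _ _ α α≉0 | suc k , ≡.refl = mk⇔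
  -- Each root of unity `ζ ≠ 1` yields the critical point with `x = α / (1 + ζ)`; the ratio
  -- hypothesis equates the two critical values.
  (λ distinct ζ₁ ζ₂ ζ₁≉1 ζ₂≉1 ζ₁ⁿ≈1 ζ₂ⁿ≈1 rⁿ≈1 →
    let x₁ , e₁ = ζ⇒parameter α≉0 ζ₁ ζ₁≉1
        x₂ , e₂ = ζ⇒parameter α≉0 ζ₂ ζ₂≉1
        crit₁   = to (critical⇔ζ^n≈1 α≉0 (suc k) e₁) ζ₁ⁿ≈1
        crit₂   = to (critical⇔ζ^n≈1 α≉0 (suc k) e₂) ζ₂ⁿ≈1
    in same-point⇒ α≉0 e₁ e₂ (distinct _ _ crit₁ crit₂
         (trans (critical-value α≉0 (suc k) x₁ crit₁)
         (trans (*-congˡ (to (same-value e₁ e₂) rⁿ≈1))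
                (sym (critical-value α≉0 (suc k) x₂ crit₂))))))
  -- Conversely, both critical points are lifted to parameters, and either alternative for `ζ₁` and
  -- `ζ₂` brings the points together.
  (λ condition τ η τ-crit η-crit gτ≈gη →
    let x₁ , ζ₁ , e₁ , y₁≈τ = critical⇒parameter α≉0 k τ-crit
        x₂ , ζ₂ , e₂ , y₂≈η = critical⇒parameter α≉0 k η-crit
        crit₁   = trans (eval-congˡ (deriv g) y₁≈τ) τ-crit
        crit₂   = trans (eval-congˡ (deriv g) y₂≈η) η-crit
        values  = trans (sym (critical-value α≉0 (suc k) x₁ crit₁))
                 (trans (eval-congˡ g y₁≈τ)
                 (trans gτ≈gη
                 (trans (sym (eval-congˡ g y₂≈η))
                        (critical-value α≉0 (suc k) x₂ crit₂))))
    in trans (sym y₁≈τ) (trans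
         ([ ζ₁≈ζ₂⇒same-point α≉0 e₁ e₂ , ζ₁≈ζ₂⁻¹⇒same-point α≉0 e₁ e₂ ]
           (condition ζ₁ ζ₂ (ζ≉1 α≉0 e₁) (ζ≉1 α≉0 e₂)
             (from (critical⇔ζ^n≈1 α≉0 (suc k) e₁) crit₁)
             (from (critical⇔ζ^n≈1 α≉0 (suc k) e₂) crit₂)
             -- The critical values are `α x₁ ^ n` and `α x₂ ^ n`, so cancelling `α` gives the ratio
             -- condition.
             (from (same-value e₁ e₂) (*-cancelˡ α≉0 values))))
         y₂≈η))
  where
  open AlgebraicClosureOf𝔽₂ K hiding (zero)
  open DerivativeReduction K
  open Evaluation commutativeSemiring
  open DiscreteFieldProperties discreteField
  open CriticalPoints K
  open Equivalence
  n = suc k ℕ.* 2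
  g = L α α≉0 (X ^ᴾ suc n)

  same-value : ∀ {x₁ x₂ ζ₁ ζ₂} → Parameter α≉0 x₁ ζ₁ → Parameter α≉0 x₂ ζ₂ →
               ((1# + ζ₁) / (1# + ζ₂)) ^ n ≈ 1# ⇔ x₁ ^ n ≈ x₂ ^ n
  same-value e₁ e₂ = r^n≈1⇔x^n≈y^n n (parameter≉0 α≉0 e₁) (ratio-parameter α≉0 e₁ e₂)
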